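{- $\ker\Lambda$ is the smallest ideal of $\mathcal H_{CK}$ which is stable under $B_+$ and contains $a\bowtie b-ab$ for all nonempty rooted trees $a,b$.
   Context: Let $k$ be a field of characteristic $0$. $\mathcal H_{CK}$ is the free commutative $k$-algebra on isomorphism classes of nonempty (non-planar, finite) rooted trees, i.e. rooted forests with unit the empty forest $\mathbf 1$; $B_+:\mathcal H_{CK}\to\mathcal H_{CK}$ is the linear map sending a forest $t_1\cdots t_n$ to the tree obtained by joining the roots of $t_1,\dots,t_n$ to a new root ($B_+(\mathbf 1)=\bullet$, the one-vertex tree). $\mathcal A=k[x]$ carries the quasi-shuffle product $\diamond$ determined by $\mathbf 1\diamond u=u\diamond\mathbf 1=u$ and $x^k\diamond x^l=(x^{k-1}\diamond x^l)x+(x^k\diamond x^{l-1})x+(x^{k-1}\diamond x^{l-1})x$ for $k,l\ge1$. $\Lambda:\mathcal H_{CK}\to(\mathcal A,\diamond)$ is the unique unital algebra morphism with $\Lambda(B_+(t_1\cdots t_n))=(\Lambda(t_1)\diamond\cdots\diamond\Lambda(t_n))x$. For trees $a=B_+(a_1\cdots a_n)$, $b=B_+(b_1\cdots b_p)$: $a\circ b=B_+(a_1\cdots a_nb)$, $a\times b=B_+(a_1\cdots a_nb_1\cdots b_p)$, $a\bowtie b=a\circ b+b\circ a+a\times b$; $ab$ is the product (forest) in $\mathcal H_{CK}$. -}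

module Defs where

open import Level using (Level; _⊔_)
open import Algebra.Apartness.Bundles using (HeytingField; HeytingCommutativeRing)
open import Algebra.Bundles using (CommutativeRing; RawRing)
import Algebra.Definitions.RawMonoid as RawMonoidOps
open import Data.List.Base using (List; []; _∷_; _++_; _∷ʳ_; [_]; map; concatMap)
open import Data.List.Relation.Binary.Permutation.Homogeneous
  using (Permutation; refl; prep; swap; trans)
open import Data.List.Relation.Binary.Pointwise.Base using (Pointwise; []; _∷_)
open import Data.Nat.Base using (ℕ; zero; suc)
open import Data.Product.Base using (_×_; _,_; map₁)
open import Relation.Binary.Bundles using (Setoid)
open import Relation.Binary.PropositionalEquality using (_≡_)
import Relation.Binary.PropositionalEquality.Properties as ≡
open import Relation.Unary using (Pred; _∈_)

-- A Heyting field is a field in the usual sense as soon as equality is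
-- decidable; its apartness x # y is invertibility of x - y.
module _ {c ℓ₁ ℓ₂} (K : HeytingField c ℓ₁ ℓ₂) where

  open HeytingField K using (heytingCommutativeRing)
  open HeytingCommutativeRing heytingCommutativeRing using (commutativeRing)

  baseRing : CommutativeRing c ℓ₁
  baseRing = commutativeRing

  HasCharacteristicZero : Set ℓ₁
  HasCharacteristicZero = ∀ n → n ·1 ≈ 0# → n ≡ 0
    where
    open CommutativeRing commutativeRing using (_≈_; 0#; 1#; +-rawMonoid)
    _·1 : ℕ → CommutativeRing.Carrier commutativeRing
    n ·1 = RawMonoidOps._×_ +-rawMonoid n 1#

record IsIdeal {a ℓ p} (R : RawRing a ℓ) (I : Pred (RawRing.Carrier R) p)
               : Set (a ⊔ ℓ ⊔ p) where
  open RawRing R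
  field
    respects-≈ : ∀ {x y} → x ≈ y → x ∈ I → y ∈ I
    0∈         : 0# ∈ I
    +-closed   : ∀ {x y} → x ∈ I → y ∈ I → x + y ∈ I
    absorbsˡ   : ∀ r {x} → x ∈ I → r * x ∈ I
    absorbsʳ   : ∀ r {x} → x ∈ I → x * r ∈ I

-- Planar representatives: node [ t₁ , … , tₙ ] is a root with the subtrees tᵢ
-- attached.  Non-planar rooted trees are these up to _≅_.
data Tree : Set where
  node : List Tree → Tree

Forest : Set
Forest = List Tree

infix 4 _≅_

data _≅_ : Tree → Tree → Set where
  node-≅ : ∀ {ts us} → Permutation _≅_ ts us → node ts ≅ node us

mutual
  ≅-refl : ∀ {t} → t ≅ t
  ≅-refl {node ts} = node-≅ (refl ≅-refl*)

  ≅-refl* : ∀ {ts} → Pointwise _≅_ ts ts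
  ≅-refl* {[]}     = []
  ≅-refl* {t ∷ ts} = ≅-refl ∷ ≅-refl*

mutual
  ≅-sym : ∀ {t u} → t ≅ u → u ≅ t
  ≅-sym (node-≅ p) = node-≅ (↭-sym p)

  ↭-sym : ∀ {ts us} → Permutation _≅_ ts us → Permutation _≅_ us ts
  ↭-sym (refl ps)    = refl (≅-sym* ps)
  ↭-sym (prep e p)   = prep (≅-sym e) (↭-sym p)
  ↭-sym (swap e f p) = swap (≅-sym f) (≅-sym e) (↭-sym p)
  ↭-sym (trans p q)  = trans (↭-sym q) (↭-sym p)

  ≅-sym* : ∀ {ts us} → Pointwise _≅_ ts us → Pointwise _≅_ us ts
  ≅-sym* []       = []
  ≅-sym* (e ∷ ps) = ≅-sym e ∷ ≅-sym* ps

forestSetoid : Setoid _ _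
forestSetoid = record
  { Carrier       = Forest
  ; _≈_           = Permutation _≅_
  ; isEquivalence = record { refl = refl ≅-refl* ; sym = ↭-sym ; trans = trans }
  }

-- a ∘ b grafts b onto the root of a; a ⊗ b (written a × b in the literature)
-- merges the two roots.
infixl 7 _∘_ _⊗_

_∘_ _⊗_ : Tree → Tree → Tree
node as ∘ b       = node (as ∷ʳ b)
node as ⊗ node bs = node (as ++ bs)

module _ {c ℓ} (R : CommutativeRing c ℓ) where

  private module R = CommutativeRing R

  -- Formal linear combinations Σ aᵢ·xᵢ; the free R-module on a setoid X is
  -- Combination (Carrier X) modulo FreeEq X.
  Combination : ∀ {a} → Set a → Set (c ⊔ a)
  Combination X = List (R.Carrier × X)

  data FreeEq {a r} (X : Setoid a r) :
              (u v : Combination (Setoid.Carrier X)) → Set (c ⊔ ℓ ⊔ a ⊔ r) where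
    refl  : ∀ {u} → FreeEq X u u
    sym   : ∀ {u v} → FreeEq X u v → FreeEq X v u
    trans : ∀ {u v w} → FreeEq X u v → FreeEq X v w → FreeEq X u w
    cons  : ∀ {α β x y u v} → α R.≈ β → Setoid._≈_ X x y → FreeEq X u v →
            FreeEq X ((α , x) ∷ u) ((β , y) ∷ v)
    swap  : ∀ {p q u} → FreeEq X (p ∷ q ∷ u) (q ∷ p ∷ u)
    merge : ∀ {α β x u} → FreeEq X ((α , x) ∷ (β , x) ∷ u) ((α R.+ β , x) ∷ u)
    drop  : ∀ {x u} → FreeEq X ((R.0# , x) ∷ u) u

  module _ {a} {X : Set a} where

    basis : X → Combination X
    basis x = [ (R.1# , x) ]

    infixl 6 _⊕_ _⊖_
    infixr 7 _·_

    _⊕_ : Combination X → Combination X → Combination X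
    _⊕_ = _++_

    _·_ : R.Carrier → Combination X → Combination X
    α · u = map (map₁ (α R.*_)) u

    neg : Combination X → Combination X
    neg = map (map₁ λ α → R.- α)

    _⊖_ : Combination X → Combination X → Combination X
    u ⊖ v = u ⊕ neg v

  module _ {a b} {X : Set a} {Y : Set b} where

    linear : (X → Combination Y) → Combination X → Combination Y
    linear f = concatMap λ (α , x) → α · f x

  module _ {a b d} {X : Set a} {Y : Set b} {Z : Set d} where

    bilinear : (X → Y → Combination Z) →
               Combination X → Combination Y → Combination Z
    bilinear f u v = linear (λ x → linear (f x) v) u

  -- The product of two forests is their disjoint union.
  H-CK : RawRing c (c ⊔ ℓ)
  H-CK = record
    { Carrier = Combination Forest
    ; _≈_     = FreeEq forestSetoid
    ; _+_     = _⊕_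
    ; _*_     = bilinear λ F G → basis (F ++ G)
    ; -_      = neg
    ; 0#      = []
    ; 1#      = basis []
    }

  module H = RawRing H-CK

  tree : Tree → H.Carrier
  tree t = basis [ t ]

  B₊ : H.Carrier → H.Carrier
  B₊ = linear λ F → tree (node F)

  infixl 6 _⋈_

  _⋈_ : Tree → Tree → H.Carrier
  a ⋈ b = tree (a ∘ b) H.+ tree (b ∘ a) H.+ tree (a ⊗ b)

  -- R[x] as the free module on the monomials; n : ℕ stands for xⁿ.
  Poly : Set c
  Poly = Combination ℕ

  infix 4 _≈ᴾ_

  _≈ᴾ_ : Poly → Poly → Set (c ⊔ ℓ)
  _≈ᴾ_ = FreeEq (≡.setoid ℕ)

  infixl 8 _·x

  _·x : Poly → Poly
  _·x = linear λ n → basis (suc n)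

  quasiShuffle : ℕ → ℕ → Poly
  quasiShuffle zero    l       = basis l
  quasiShuffle (suc k) zero    = basis (suc k)
  quasiShuffle (suc k) (suc l) =
    quasiShuffle k (suc l) ·x ⊕ quasiShuffle (suc k) l ·x ⊕ quasiShuffle k l ·x

  infixr 7 _⋄_

  _⋄_ : Poly → Poly → Poly
  _⋄_ = bilinear quasiShuffle

  -- The values on trees and forests are forced by Λ being a unital algebra
  -- morphism (H-CK, ·) → (R[x], ⋄) with Λ (B₊ (t₁⋯tₙ)) = (Λ t₁ ⋄ ⋯ ⋄ Λ tₙ) x.
  mutual
    Λ-tree : Tree → Poly
    Λ-tree (node ts) = Λ-forest ts ·x

    Λ-forest : Forest → Poly
    Λ-forest []       = basis 0
    Λ-forest (t ∷ ts) = Λ-tree t ⋄ Λ-forest ts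

  Λ : H.Carrier → Poly
  Λ = linear Λ-forest

  ker-Λ : Pred H.Carrier (c ⊔ ℓ)
  ker-Λ u = Λ u ≈ᴾ []

  record IsStableIdealWithRelations {p} (I : Pred H.Carrier p)
                                    : Set (c ⊔ ℓ ⊔ p) where
    field
      isIdeal   : IsIdeal H-CK I
      B₊-stable : ∀ {u} → u ∈ I → B₊ u ∈ I
      relations : ∀ a b → (a ⋈ b) ⊖ (tree a H.* tree b) ∈ I

{-# OPTIONS --safe #-}

-- That Λ is well defined, multiplicative and kills the relations comes down to
-- the commutativity and associativity of ⋄ and to the recursion
-- px ⋄ qx = (p ⋄ qx)x + (px ⋄ q)x + (p ⋄ q)x for arbitrary polynomials p, q.
-- For minimality, send xⁿ to the ladder with n vertices.  Modulo a B₊-stable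
-- ideal J containing the relations, the product of two ladders is the image of
-- the quasi-shuffle of the corresponding monomials, because a ⋈ b = ab mod J
-- unfolds to that recursion.  Hence every forest is congruent mod J to a
-- combination of ladders determined by its image under Λ, and elements of ker Λ
-- are congruent to 0.
module Submission where

open import Defs
open import Algebra.Apartness.Bundles using (HeytingField)
open import Algebra.Bundles using (CommutativeRing; AbelianGroup)
import Algebra.Properties.Group as GroupProperties
import Algebra.Properties.Ring as RingProperties
import Algebra.Solver.CommutativeMonoid as CommutativeMonoidSolver
open import Data.List.Base using ([]; _∷_; _++_; [_])
open import Data.List.Properties using (++-assoc; ++-identityʳ; map-++; concatMap-++)
open import Data.List.Relation.Binary.Permutation.Homogeneous
  using (Permutation; refl; prep; swap; trans)
open import Data.List.Relation.Binary.Pointwise.Base using (Pointwise; []; _∷_)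
open import Data.Nat.Base using (ℕ; zero; suc)
open import Data.Product.Base using (_×_; _,_)
open import Relation.Binary.Bundles using (Setoid)
import Relation.Binary.PropositionalEquality as ≡
import Relation.Binary.Reasoning.Setoid as SetoidReasoning
open import Relation.Unary using (Pred; _⊆_; _∈_)

-- Free modules as lists of terms: module laws and linear extension.

module FreeModule {c ℓ} (R : CommutativeRing c ℓ) where

  private module R = CommutativeRing R

  infixl 6 _+_ _-_
  infixr 7 _∙_

  _+_ _-_ : ∀ {a} {X : Set a} → Combination R X → Combination R X → Combination R X
  _+_ = _⊕_ R
  _-_ = _⊖_ R

  _∙_ : ∀ {a} {X : Set a} → R.Carrier → Combination R X → Combination R X
  _∙_ = _·_ R

  module _ {a r} {X : Setoid a r} where

    private
      module X = Setoid X
      C = Combination R X.Carrier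

      infix 4 _≈_
      _≈_ : C → C → Set _
      _≈_ = FreeEq R X

    -- Every generator of `FreeEq` acts at the head of a list with an arbitrary tail, so appending
    -- `w` turns a derivation into one of the same shape.
    +-congʳ : ∀ {u v} w → u ≈ v → u + w ≈ v + w
    +-congʳ w refl         = refl
    +-congʳ w (sym p)      = sym (+-congʳ w p)
    +-congʳ w (trans p q)  = trans (+-congʳ w p) (+-congʳ w q)
    +-congʳ w (cons e f p) = cons e f (+-congʳ w p)
    +-congʳ w swap         = swap
    +-congʳ w merge        = merge
    +-congʳ w drop         = drop

    +-congˡ : ∀ w {u v} → u ≈ v → w + u ≈ w + v
    +-congˡ []      p = p
    +-congˡ (_ ∷ w) p = cons R.refl X.refl (+-congˡ w p)

    +-cong : ∀ {u u′ v v′} → u ≈ u′ → v ≈ v′ → u + v ≈ u′ + v′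
    +-cong {u′ = u′} {v} p q = trans (+-congʳ v p) (+-congˡ u′ q)

    ≡⇒≈ : ∀ {u v} → u ≡.≡ v → u ≈ v
    ≡⇒≈ ≡.refl = refl

    +-identityʳ : ∀ u → u + [] ≈ u
    +-identityʳ u = ≡⇒≈ (++-identityʳ u)

    ∷-shift : ∀ t u {v} → t ∷ (u + v) ≈ u + (t ∷ v)
    ∷-shift t []      = refl
    ∷-shift t (_ ∷ u) = trans swap (cons R.refl X.refl (∷-shift t u))

    +-comm : ∀ u v → u + v ≈ v + u
    +-comm []      v = sym (+-identityʳ v)
    +-comm (t ∷ u) v = trans (cons R.refl X.refl (+-comm u v)) (∷-shift t v)

    ∙-congʳ : ∀ {α β} u → α R.≈ β → α ∙ u ≈ β ∙ u
    ∙-congʳ []      e = refl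
    ∙-congʳ (_ ∷ u) e = cons (R.*-congʳ e) X.refl (∙-congʳ u e)

    ∙-congˡ : ∀ α {u v} → u ≈ v → α ∙ u ≈ α ∙ v
    ∙-congˡ α refl         = refl
    ∙-congˡ α (sym p)      = sym (∙-congˡ α p)
    ∙-congˡ α (trans p q)  = trans (∙-congˡ α p) (∙-congˡ α q)
    ∙-congˡ α (cons e f p) = cons (R.*-congˡ e) f (∙-congˡ α p)
    ∙-congˡ α swap         = swap
    ∙-congˡ α merge        = trans merge (cons (R.sym (R.distribˡ _ _ _)) X.refl refl)
    ∙-congˡ α drop         = trans (cons (R.zeroʳ α) X.refl refl) drop

    ∙-distribʳ : ∀ α β u → (α R.+ β) ∙ u ≈ α ∙ u + β ∙ u
    ∙-distribʳ α β []            = refl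
    ∙-distribʳ α β ((γ , x) ∷ u) =
      trans (cons (R.distribʳ γ α β) X.refl (∙-distribʳ α β u))
      -- `merge` read backwards splits the head coefficient in two; the second copy is then moved
      -- past `α ∙ u` to the front of `β ∙ u`.
      (trans (sym merge) (cons R.refl X.refl (∷-shift _ (α ∙ u))))

    ∙-distribˡ : ∀ α u v → α ∙ (u + v) ≈ α ∙ u + α ∙ v
    ∙-distribˡ α u v = ≡⇒≈ (map-++ _ u v)

    ∙-assoc : ∀ α β u → α ∙ β ∙ u ≈ (α R.* β) ∙ u
    ∙-assoc α β []      = refl
    ∙-assoc α β (_ ∷ u) = cons (R.sym (R.*-assoc _ _ _)) X.refl (∙-assoc α β u)

    ∙-swap : ∀ α β u → α ∙ β ∙ u ≈ β ∙ α ∙ u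
    ∙-swap α β u = trans (∙-assoc α β u)
      (trans (∙-congʳ u (R.*-comm α β)) (sym (∙-assoc β α u)))

    0∙ : ∀ u → R.0# ∙ u ≈ []
    0∙ []      = refl
    0∙ (_ ∷ u) = trans (cons (R.zeroˡ _) X.refl (0∙ u)) drop

    1∙ : ∀ u → R.1# ∙ u ≈ u
    1∙ []      = refl
    1∙ (_ ∷ u) = cons (R.*-identityˡ _) X.refl (1∙ u)

    -- Reduces negation to scaling, so that congruence, inverses and linearity for `neg` follow from
    -- the laws of `_∙_`.
    neg≈-1∙ : ∀ u → neg R u ≈ (R.- R.1#) ∙ u
    neg≈-1∙ []      = refl
    neg≈-1∙ (_ ∷ u) =
      cons (R.sym (RingProperties.-1*x≈-x R.ring _)) X.refl (neg≈-1∙ u)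

    neg-cong : ∀ {u v} → u ≈ v → neg R u ≈ neg R v
    neg-cong {u} {v} p =
      trans (neg≈-1∙ u) (trans (∙-congˡ _ p) (sym (neg≈-1∙ v)))

    +-inverseʳ : ∀ u → u - u ≈ []
    +-inverseʳ u = trans (+-cong (sym (1∙ u)) (neg≈-1∙ u))
      (trans (sym (∙-distribʳ R.1# (R.- R.1#) u))
      (trans (∙-congʳ u (R.-‿inverseʳ R.1#)) (0∙ u)))

  +-abelianGroup : ∀ {a r} → Setoid a r → AbelianGroup _ _
  +-abelianGroup X = record
    { Carrier = Combination R (Setoid.Carrier X)
    ; _≈_     = FreeEq R X
    ; _∙_     = _+_
    ; ε       = []
    ; _⁻¹     = neg R
    ; isAbelianGroup = record
      { isGroup = record
        { isMonoid = record
          { isSemigroup = record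
            { isMagma = record
              { isEquivalence = record { refl = refl ; sym = sym ; trans = trans }
              ; ∙-cong        = +-cong
              }
            ; assoc = λ u v w → ≡⇒≈ (++-assoc u v w)
            }
          ; identity = (λ _ → refl) , +-identityʳ
          }
        ; inverse = (λ u → trans (+-comm (neg R u) u) (+-inverseʳ u)) , +-inverseʳ
        ; ⁻¹-cong = neg-cong
        }
      ; comm = +-comm
      }
    }

  +-interchange : ∀ {a r} {X : Setoid a r} u v w z →
    FreeEq R X ((u + v) + (w + z)) ((u + w) + (v + z))
  +-interchange {X = X} = solve 4
    (λ u v w z → (u ⊕′ v) ⊕′ (w ⊕′ z) ⊜ (u ⊕′ w) ⊕′ (v ⊕′ z)) refl
    where
    open CommutativeMonoidSolver (AbelianGroup.commutativeMonoid (+-abelianGroup X))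
      using (solve; _⊜_) renaming (_⊕_ to _⊕′_)

  -- Linearity of the linear extension, in its argument and in the map on generators.

  module _ {a b r} {X : Set a} {Y : Setoid b r} where

    private
      D = Combination R (Setoid.Carrier Y)

      infix 4 _≈_
      _≈_ : D → D → Set _
      _≈_ = FreeEq R Y

    open SetoidReasoning (AbelianGroup.setoid (+-abelianGroup Y))

    linear-+ : ∀ (f : X → D) u v → linear R f (u + v) ≈ linear R f u + linear R f v
    linear-+ f u v = ≡⇒≈ (concatMap-++ _ u v)

    linear-∙ : ∀ (f : X → D) α u → linear R f (α ∙ u) ≈ α ∙ linear R f u
    linear-∙ f α []            = refl
    linear-∙ f α ((β , x) ∷ u) =
      trans (+-cong (sym (∙-assoc α β (f x))) (linear-∙ f α u))
            (sym (∙-distribˡ α (β ∙ f x) (linear R f u)))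

    linear-neg : ∀ (f : X → D) u → linear R f (neg R u) ≈ neg R (linear R f u)
    linear-neg f []            = refl
    linear-neg f ((β , x) ∷ u) = begin
      (R.- β) ∙ f x + linear R f (neg R u)
        ≈⟨ +-cong (∙-congʳ (f x) (R.sym (RingProperties.-1*x≈-x R.ring β)))
                  (trans (linear-neg f u) (neg≈-1∙ (linear R f u))) ⟩
      ((R.- R.1#) R.* β) ∙ f x + (R.- R.1#) ∙ linear R f u
        ≈⟨ +-congʳ _ (∙-assoc (R.- R.1#) β (f x)) ⟨
      (R.- R.1#) ∙ β ∙ f x + (R.- R.1#) ∙ linear R f u
        ≈⟨ ∙-distribˡ _ (β ∙ f x) _ ⟨
      (R.- R.1#) ∙ (β ∙ f x + linear R f u)
        ≈⟨ neg≈-1∙ _ ⟨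
      neg R (β ∙ f x + linear R f u) ∎

    linear-- : ∀ (f : X → D) u v → linear R f (u - v) ≈ linear R f u - linear R f v
    linear-- f u v =
      trans (linear-+ f u (neg R v)) (+-congˡ (linear R f u) (linear-neg f v))

    linear-basis : ∀ (f : X → D) x → linear R f (basis R x) ≈ f x
    linear-basis f x = trans (+-identityʳ _) (1∙ (f x))

    linear-cong : ∀ {f g : X → D} → (∀ x → f x ≈ g x) →
                  ∀ u → linear R f u ≈ linear R g u
    linear-cong f≈g []            = refl
    linear-cong f≈g ((α , x) ∷ u) = +-cong (∙-congˡ α (f≈g x)) (linear-cong f≈g u)

    linear-pointwise-0 : ∀ u → linear R {X = X} (λ _ → []) u ≈ []
    linear-pointwise-0 []      = refl
    linear-pointwise-0 (_ ∷ u) = linear-pointwise-0 u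

    linear-pointwise-+ : ∀ (f g : X → D) u →
      linear R (λ x → f x + g x) u ≈ linear R f u + linear R g u
    linear-pointwise-+ f g []            = refl
    linear-pointwise-+ f g ((α , x) ∷ u) =
      trans (+-cong (∙-distribˡ α (f x) (g x)) (linear-pointwise-+ f g u))
            (+-interchange (α ∙ f x) (α ∙ g x) _ _)

    linear-pointwise-∙ : ∀ α (f : X → D) u →
      linear R (λ x → α ∙ f x) u ≈ α ∙ linear R f u
    linear-pointwise-∙ α f []            = refl
    linear-pointwise-∙ α f ((β , x) ∷ u) =
      trans (+-cong (∙-swap β α (f x)) (linear-pointwise-∙ α f u))
            (sym (∙-distribˡ α (β ∙ f x) _))

    linear-pointwise-- : ∀ (f g : X → D) u →
      linear R (λ x → f x - g x) u ≈ linear R f u - linear R g u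
    linear-pointwise-- f g u = begin
      linear R (λ x → f x - g x) u
        ≈⟨ linear-cong (λ x → +-congˡ (f x) (neg≈-1∙ (g x))) u ⟩
      linear R (λ x → f x + (R.- R.1#) ∙ g x) u
        ≈⟨ linear-pointwise-+ f _ u ⟩
      linear R f u + linear R (λ x → (R.- R.1#) ∙ g x) u
        ≈⟨ +-congˡ _ (trans (linear-pointwise-∙ _ g u) (sym (neg≈-1∙ _))) ⟩
      linear R f u - linear R g u ∎

  -- The universal property of the free module: each rule generating `FreeEq` is sent to a module
  -- law, for instance `merge` to distributivity and `drop` to `0∙`.
  linear-respects-≈ : ∀ {a r b s} {X : Setoid a r} {Y : Setoid b s}
    {f : Setoid.Carrier X → Combination R (Setoid.Carrier Y)} →
    (∀ {x y} → Setoid._≈_ X x y → FreeEq R Y (f x) (f y)) →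
    ∀ {u v} → FreeEq R X u v → FreeEq R Y (linear R f u) (linear R f v)
  linear-respects-≈ {X = X} {Y} {f} f-cong = go
    where
    go : ∀ {u v} → FreeEq R X u v → FreeEq R Y (linear R f u) (linear R f v)
    go refl                               = refl
    go (sym p)                            = sym (go p)
    go (trans p q)                        = trans (go p) (go q)
    go (cons {α} {β} {x} {y} e e′ p)      =
      +-cong (trans (∙-congˡ α (f-cong e′)) (∙-congʳ (f y) e)) (go p)
    -- A single term becomes a whole block `α ∙ f x`, so exchanging two terms becomes commutativity
    -- of the sum of the two leading blocks.
    go (swap {α , x} {β , y} {u})         =
      trans (≡⇒≈ (≡.sym (++-assoc (α ∙ f x) (β ∙ f y) _)))
      (trans (+-congʳ (linear R f u) (+-comm (α ∙ f x) (β ∙ f y)))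
             (≡⇒≈ (++-assoc (β ∙ f y) (α ∙ f x) _)))
    go (merge {α} {β} {x} {u})            =
      trans (≡⇒≈ (≡.sym (++-assoc (α ∙ f x) (β ∙ f x) _)))
            (+-congʳ (linear R f u) (sym (∙-distribʳ α β (f x))))
    go (drop {x} {u})                     = +-congʳ (linear R f u) (0∙ (f x))

  linear-identity : ∀ {a r} {X : Setoid a r} u → FreeEq R X (linear R (basis R) u) u
  linear-identity         []      = refl
  linear-identity {X = X} (_ ∷ u) =
    cons (R.*-identityʳ _) (Setoid.refl X) (linear-identity u)

  linear-linear : ∀ {a b d r} {X : Set a} {Y : Set b} {Z : Setoid d r}
    (g : Y → Combination R (Setoid.Carrier Z)) (f : X → Combination R Y) u →
    FreeEq R Z (linear R g (linear R f u)) (linear R (λ x → linear R g (f x)) u)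
  linear-linear g f []            = refl
  linear-linear g f ((α , x) ∷ u) =
    trans (linear-+ g (α ∙ f x) (linear R f u))
          (+-cong (linear-∙ g α (f x)) (linear-linear g f u))

  -- Bilinear extension.

  module _ {a b d r} {X : Set a} {Y : Set b} {Z : Setoid d r} where

    private
      E = Combination R (Setoid.Carrier Z)

      infix 4 _≈_
      _≈_ : E → E → Set _
      _≈_ = FreeEq R Z

    bilinear-cong : ∀ {f g : X → Y → E} → (∀ x y → f x y ≈ g x y) →
                    ∀ u v → bilinear R f u v ≈ bilinear R g u v
    bilinear-cong f≈g u v = linear-cong (λ x → linear-cong (f≈g x) v) u

    -- Interchange of two finite sums. `bilinear` sums over its first argument outermost; the flip
    -- makes the second argument equally accessible.
    bilinear-flip : ∀ (f : X → Y → E) u v →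
      bilinear R f u v ≈ bilinear R (λ y x → f x y) v u
    bilinear-flip f []            v = sym (linear-pointwise-0 v)
    bilinear-flip f ((α , x) ∷ u) v =
      trans (+-cong (sym (linear-pointwise-∙ α (f x) v)) (bilinear-flip f u v))
            (sym (linear-pointwise-+ (λ y → α ∙ f x y) _ v))

    bilinear-basis : ∀ (f : X → Y → E) x y →
      bilinear R f (basis R x) (basis R y) ≈ f x y
    bilinear-basis f x y = 
      trans (linear-basis (λ x → linear R (f x) (basis R y)) x) (linear-basis (f x) y)

    bilinear-+ʳ : ∀ (f : X → Y → E) u v w →
      bilinear R f u (v + w) ≈ bilinear R f u v + bilinear R f u w
    bilinear-+ʳ f u v w =
      trans (linear-cong (λ x → linear-+ (f x) v w) u) (linear-pointwise-+ _ _ u)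

    bilinear--ʳ : ∀ (f : X → Y → E) u v w →
      bilinear R f u (v - w) ≈ bilinear R f u v - bilinear R f u w
    bilinear--ʳ f u v w =
      trans (linear-cong (λ x → linear-- (f x) v w) u) (linear-pointwise-- _ _ u)

    bilinear-pointwise-+ : ∀ (f g : X → Y → E) u v →
      bilinear R (λ x y → f x y + g x y) u v ≈ bilinear R f u v + bilinear R g u v
    bilinear-pointwise-+ f g u v =
      trans (linear-cong (λ x → linear-pointwise-+ (f x) (g x) v) u)
            (linear-pointwise-+ _ _ u)

  linear-bilinear : ∀ {a b d e r} {X : Set a} {Y : Set b} {Z : Set d} {W : Setoid e r}
    (h : Z → Combination R (Setoid.Carrier W)) (f : X → Y → Combination R Z) u v →
    FreeEq R W (linear R h (bilinear R f u v))
               (bilinear R (λ x y → linear R h (f x y)) u v)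
  linear-bilinear h f u v =
    trans (linear-linear h _ u) (linear-cong (λ x → linear-linear h (f x) v) u)

  bilinear-linearʳ : ∀ {a b d e r} {X : Set a} {Y : Set b} {V : Set d} {Z : Setoid e r}
    (f : X → Y → Combination R (Setoid.Carrier Z)) u (h : V → Combination R Y) v →
    FreeEq R Z (bilinear R f u (linear R h v))
               (linear R (λ y → bilinear R f u (h y)) v)
  bilinear-linearʳ f u h v =
    trans (bilinear-flip f u (linear R h v))
    (trans (linear-linear _ h v)
           (linear-cong (λ y → sym (bilinear-flip f u (h y))) v))

  bilinear-linear : ∀ {a a′ b b′ d r} {X : Set a} {Y : Set b} {U : Set a′} {V : Set b′}
    {Z : Setoid d r} (f : X → Y → Combination R (Setoid.Carrier Z))
    (g : U → Combination R X) (h : V → Combination R Y) u v →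
    FreeEq R Z (bilinear R f (linear R g u) (linear R h v))
               (bilinear R (λ x y → bilinear R f (g x) (h y)) u v)
  bilinear-linear f g h u v =
    trans (linear-linear _ g u)
          (linear-cong (λ x → bilinear-linearʳ f (g x) h v) u)

-- The quasi-shuffle algebra: commutativity, unit and the recursion for polynomials.

module QuasiShuffle {c ℓ} (R : CommutativeRing c ℓ) where

  open FreeModule R

  private
    module S = CommutativeMonoidSolver
      (AbelianGroup.commutativeMonoid (+-abelianGroup (≡.setoid ℕ)))
  open SetoidReasoning (AbelianGroup.setoid (+-abelianGroup (≡.setoid ℕ)))

  infix 4 _≈_
  infixl 8 _▹x
  infixr 7 _◇_

  _≈_ : Poly R → Poly R → Set _
  _≈_ = _≈ᴾ_ R

  _▹x : Poly R → Poly R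
  _▹x = _·x R

  _◇_ : Poly R → Poly R → Poly R
  _◇_ = _⋄_ R

  qs : ℕ → ℕ → Poly R
  qs = quasiShuffle R

  raise : ℕ → Poly R
  raise n = basis R (suc n)

  linear-congᴾ : ∀ (f : ℕ → Poly R) {p q} → p ≈ q → linear R f p ≈ linear R f q
  linear-congᴾ f = linear-respects-≈ λ { ≡.refl → refl }

  ▹x-cong : ∀ {p q} → p ≈ q → p ▹x ≈ q ▹x
  ▹x-cong = linear-congᴾ raise

  ▹x-+ : ∀ p q → (p + q) ▹x ≈ p ▹x + q ▹x
  ▹x-+ = linear-+ raise

  ◇-cong : ∀ {p p′ q q′} → p ≈ p′ → q ≈ q′ → p ◇ q ≈ p′ ◇ q′
  ◇-cong {p′ = p′} {q} e e′ =
    trans (linear-congᴾ (λ k → linear R (qs k) q) e)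
          (linear-cong (λ k → linear-congᴾ (qs k) e′) p′)

  ◇-congʳ : ∀ {p p′} q → p ≈ p′ → p ◇ q ≈ p′ ◇ q
  ◇-congʳ q e = ◇-cong {q = q} e refl

  ◇-congˡ : ∀ p {q q′} → q ≈ q′ → p ◇ q ≈ p ◇ q′
  ◇-congˡ p e = ◇-cong {p} refl e

  ◇-distribʳ : ∀ r p q → (p + q) ◇ r ≈ p ◇ r + q ◇ r
  ◇-distribʳ r = linear-+ λ k → linear R (qs k) r

  ◇-distribˡ : ∀ p q r → p ◇ (q + r) ≈ p ◇ q + p ◇ r
  ◇-distribˡ = bilinear-+ʳ qs

  -- Exchanging `k` and `l` swaps the first two summands of the recursion and fixes the third.
  qs-comm : ∀ k l → qs k l ≈ qs l k
  qs-comm zero    zero    = refl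
  qs-comm zero    (suc l) = refl
  qs-comm (suc k) zero    = refl
  qs-comm (suc k) (suc l) =
    +-cong (trans (+-comm (qs k (suc l) ▹x) (qs (suc k) l ▹x))
                  (+-cong (▹x-cong (qs-comm (suc k) l)) (▹x-cong (qs-comm k (suc l)))))
           (▹x-cong (qs-comm k l))

  ◇-comm : ∀ p q → p ◇ q ≈ q ◇ p
  ◇-comm p q = trans (bilinear-flip qs p q) (bilinear-cong (λ l k → qs-comm k l) q p)

  ◇-identityˡ : ∀ p → basis R 0 ◇ p ≈ p
  ◇-identityˡ p = trans (linear-basis (λ k → linear R (qs k) p) 0) (linear-identity p)

  ◇-identityʳ : ∀ p → p ◇ basis R 0 ≈ p
  ◇-identityʳ p = trans (◇-comm p (basis R 0)) (◇-identityˡ p)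

  -- Both sides are bilinear in `p` and `q`, and on monomials the identity is the defining clause of
  -- `quasiShuffle` at two successors.
  ◇-▹x : ∀ p q → p ▹x ◇ q ▹x ≈ (p ◇ q ▹x) ▹x + (p ▹x ◇ q) ▹x + (p ◇ q) ▹x
  ◇-▹x p q = begin
    p ▹x ◇ q ▹x
      ≈⟨ bilinear-linear qs raise raise p q ⟩
    bilinear R (λ k l → basis R (suc k) ◇ basis R (suc l)) p q
      ≈⟨ bilinear-cong (λ k l → bilinear-basis qs (suc k) (suc l)) p q ⟩
    bilinear R (λ k l → qs k (suc l) ▹x + qs (suc k) l ▹x + qs k l ▹x) p q
      ≈⟨ trans (bilinear-pointwise-+ _ _ p q)
               (+-congʳ _ (bilinear-pointwise-+ _ _ p q)) ⟩
    bilinear R (λ k l → qs k (suc l) ▹x) p q + bilinear R (λ k l → qs (suc k) l ▹x) p q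
      + bilinear R (λ k l → qs k l ▹x) p q
      ≈⟨ +-cong (+-cong (linear-bilinear raise (λ k l → qs k (suc l)) p q)
                        (linear-bilinear raise (λ k l → qs (suc k) l) p q))
                (linear-bilinear raise qs p q) ⟨
    bilinear R (λ k l → qs k (suc l)) p q ▹x + bilinear R (λ k l → qs (suc k) l) p q ▹x
      + (p ◇ q) ▹x
      ≈⟨ +-congʳ _ (+-cong (▹x-cong shiftʳ) (▹x-cong shiftˡ)) ⟨
    (p ◇ q ▹x) ▹x + (p ▹x ◇ q) ▹x + (p ◇ q) ▹x ∎
    where
    shiftʳ : p ◇ q ▹x ≈ bilinear R (λ k l → qs k (suc l)) p q
    shiftʳ = linear-cong (λ k → trans (linear-linear (qs k) raise q)
                                      (linear-cong (λ l → linear-basis (qs k) (suc l)) q)) p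

    shiftˡ : p ▹x ◇ q ≈ bilinear R (λ k l → qs (suc k) l) p q
    shiftˡ = trans (linear-linear (λ k → linear R (qs k) q) raise p)
      (linear-cong (λ k → linear-basis (λ l → linear R (qs l) q) (suc k)) p)

  -- Associativity of the quasi-shuffle product.

  Associative : Poly R → Poly R → Poly R → Set _
  Associative p q r = (p ◇ q) ◇ r ≈ p ◇ (q ◇ r)

  -- The induction step for associativity. The seven hypotheses are the triples in which at least
  -- one factor has lost its `x`; expanding either side by `◇-▹x` yields exactly these seven
  -- products under a common `▹x`.
  ◇-assoc-▹x : ∀ p q r →
    Associative p (q ▹x) (r ▹x) → Associative (p ▹x) q (r ▹x) →
    Associative p q (r ▹x) → Associative (p ▹x) (q ▹x) r →
    Associative p (q ▹x) r → Associative (p ▹x) q r → Associative p q r →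
    Associative (p ▹x) (q ▹x) (r ▹x)
  ◇-assoc-▹x p q r h₁ h₂ h₃ h₄ h₅ h₆ h₇ = begin
    (p ▹x ◇ q ▹x) ◇ r ▹x
      ≈⟨ ◇-congʳ (r ▹x) pq ⟩
    s ▹x ◇ r ▹x
      ≈⟨ ◇-▹x s r ⟩
    (s ◇ r ▹x) ▹x + (s ▹x ◇ r) ▹x + (s ◇ r) ▹x
      ≈⟨ merge-▹x (s ◇ r ▹x) (s ▹x ◇ r) (s ◇ r) ⟨
    (s ◇ r ▹x + s ▹x ◇ r + s ◇ r) ▹x
      ≈⟨ ▹x-cong inner ⟩
    (p ◇ t ▹x + p ▹x ◇ t + p ◇ t) ▹x
      ≈⟨ merge-▹x (p ◇ t ▹x) (p ▹x ◇ t) (p ◇ t) ⟩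
    (p ◇ t ▹x) ▹x + (p ▹x ◇ t) ▹x + (p ◇ t) ▹x
      ≈⟨ ◇-▹x p t ⟨
    p ▹x ◇ t ▹x
      ≈⟨ ◇-congˡ (p ▹x) qr ⟨
    p ▹x ◇ (q ▹x ◇ r ▹x) ∎
    where
    s = p ◇ q ▹x + p ▹x ◇ q + p ◇ q
    t = q ◇ r ▹x + q ▹x ◇ r + q ◇ r

    merge-▹x : ∀ u v w → (u + v + w) ▹x ≈ u ▹x + v ▹x + w ▹x
    merge-▹x u v w = trans (▹x-+ (u + v) w) (+-congʳ (w ▹x) (▹x-+ u v))

    pq : p ▹x ◇ q ▹x ≈ s ▹x
    pq = trans (◇-▹x p q) (sym (merge-▹x (p ◇ q ▹x) (p ▹x ◇ q) (p ◇ q)))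

    qr : q ▹x ◇ r ▹x ≈ t ▹x
    qr = trans (◇-▹x q r) (sym (merge-▹x (q ◇ r ▹x) (q ▹x ◇ r) (q ◇ r)))

    expandʳ : ∀ z → s ◇ z ≈ (p ◇ q ▹x) ◇ z + (p ▹x ◇ q) ◇ z + (p ◇ q) ◇ z
    expandʳ z = trans (◇-distribʳ z (p ◇ q ▹x + p ▹x ◇ q) (p ◇ q))
      (+-congʳ ((p ◇ q) ◇ z) (◇-distribʳ z (p ◇ q ▹x) (p ▹x ◇ q)))

    expandˡ : ∀ z → z ◇ t ≈ z ◇ (q ◇ r ▹x) + z ◇ (q ▹x ◇ r) + z ◇ (q ◇ r)
    expandˡ z = trans (◇-distribˡ z (q ◇ r ▹x + q ▹x ◇ r) (q ◇ r))
      (+-congʳ (z ◇ (q ◇ r)) (◇-distribˡ z (q ◇ r ▹x) (q ▹x ◇ r)))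

    -- Groups the summands for refolding into `t`: `b`, `d`, `f` have left factor `p ▹x`, and `c`,
    -- `e`, `g` have left factor `p`. The term `a` also has left factor `p` but stays apart, since
    -- it becomes `p ◇ t ▹x` through `qr`.
    rearrange : ∀ a b c d e f g →
      (a + b + c) + d + (e + f + g) ≈ (a + (b + d + f) + (c + e + g))
    rearrange = S.solve 7 (λ a b c d e f g →
      ((((a S.⊕ b) S.⊕ c) S.⊕ d) S.⊕ ((e S.⊕ f) S.⊕ g)) S.⊜
      ((a S.⊕ ((b S.⊕ d) S.⊕ f)) S.⊕ ((c S.⊕ e) S.⊕ g))) refl

    inner : s ◇ r ▹x + s ▹x ◇ r + s ◇ r ≈ p ◇ t ▹x + p ▹x ◇ t + p ◇ t
    inner = begin
      s ◇ r ▹x + s ▹x ◇ r + s ◇ r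
        -- The middle `s ▹x` is folded back to `p ▹x ◇ q ▹x` instead of being expanded, so that the
        -- single hypothesis `h₄` covers it.
        ≈⟨ +-cong (+-cong (expandʳ (r ▹x)) (◇-congʳ r (sym pq))) (expandʳ r) ⟩
      ((p ◇ q ▹x) ◇ r ▹x + (p ▹x ◇ q) ◇ r ▹x + (p ◇ q) ◇ r ▹x)
        + (p ▹x ◇ q ▹x) ◇ r + ((p ◇ q ▹x) ◇ r + (p ▹x ◇ q) ◇ r + (p ◇ q) ◇ r)
        ≈⟨ +-cong (+-cong (+-cong (+-cong h₁ h₂) h₃) h₄) (+-cong (+-cong h₅ h₆) h₇) ⟩
      (p ◇ (q ▹x ◇ r ▹x) + p ▹x ◇ (q ◇ r ▹x) + p ◇ (q ◇ r ▹x))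
        + p ▹x ◇ (q ▹x ◇ r) + (p ◇ (q ▹x ◇ r) + p ▹x ◇ (q ◇ r) + p ◇ (q ◇ r))
        ≈⟨ rearrange (p ◇ (q ▹x ◇ r ▹x)) (p ▹x ◇ (q ◇ r ▹x)) (p ◇ (q ◇ r ▹x))
             (p ▹x ◇ (q ▹x ◇ r)) (p ◇ (q ▹x ◇ r)) (p ▹x ◇ (q ◇ r)) (p ◇ (q ◇ r)) ⟩
      p ◇ (q ▹x ◇ r ▹x) + (p ▹x ◇ (q ◇ r ▹x) + p ▹x ◇ (q ▹x ◇ r) + p ▹x ◇ (q ◇ r))
        + (p ◇ (q ◇ r ▹x) + p ◇ (q ▹x ◇ r) + p ◇ (q ◇ r))
        ≈⟨ +-cong (+-cong (◇-congˡ p qr) (sym (expandˡ (p ▹x)))) (sym (expandˡ p)) ⟩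
      p ◇ t ▹x + p ▹x ◇ t + p ◇ t ∎

  -- Monomials as iterated `_▹x`: a successor is then literally of the form `p ▹x`, as `◇-assoc-▹x`
  -- demands, while `basis R (suc n)` has that form only up to `≈`.
  x^_ : ℕ → Poly R
  x^ zero  = basis R 0
  x^ suc n = (x^ n) ▹x

  basis≈x^ : ∀ n → basis R n ≈ x^ n
  basis≈x^ zero    = refl
  basis≈x^ (suc n) =
    trans (sym (linear-basis (λ m → basis R (suc m)) n)) (▹x-cong (basis≈x^ n))

  x^-assoc : ∀ k l m → Associative (x^ k) (x^ l) (x^ m)
  x^-assoc zero l m =
    trans (◇-congʳ (x^ m) (◇-identityˡ (x^ l))) (sym (◇-identityˡ (x^ l ◇ x^ m)))
  x^-assoc (suc k) zero m =
    ◇-cong (◇-identityʳ (x^ suc k)) (sym (◇-identityˡ (x^ m)))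
  x^-assoc (suc k) (suc l) zero =
    trans (◇-identityʳ (x^ suc k ◇ x^ suc l))
          (◇-congˡ (x^ suc k) (sym (◇-identityʳ (x^ suc l))))
  x^-assoc (suc k) (suc l) (suc m) = ◇-assoc-▹x (x^ k) (x^ l) (x^ m)
    (x^-assoc k (suc l) (suc m)) (x^-assoc (suc k) l (suc m))
    (x^-assoc k l (suc m)) (x^-assoc (suc k) (suc l) m)
    (x^-assoc k (suc l) m) (x^-assoc (suc k) l m) (x^-assoc k l m)

  -- Associativity on monomials in terms of structure constants, the shape that appears once
  -- `◇-assoc` is expanded by trilinearity.
  qs-assoc : ∀ k l m → linear R (λ n → qs n m) (qs k l) ≈ linear R (qs k) (qs l m)
  qs-assoc k l m = begin
    linear R (λ n → qs n m) (qs k l)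
      ≈⟨ linear-cong (λ n → linear-basis (qs n) m) (qs k l) ⟨
    qs k l ◇ basis R m
      ≈⟨ ◇-congʳ (basis R m) (bilinear-basis qs k l) ⟨
    (basis R k ◇ basis R l) ◇ basis R m
      ≈⟨ ◇-cong (◇-cong (basis≈x^ k) (basis≈x^ l)) (basis≈x^ m) ⟩
    (x^ k ◇ x^ l) ◇ x^ m
      ≈⟨ x^-assoc k l m ⟩
    x^ k ◇ (x^ l ◇ x^ m)
      ≈⟨ ◇-cong (basis≈x^ k) (◇-cong (basis≈x^ l) (basis≈x^ m)) ⟨
    basis R k ◇ (basis R l ◇ basis R m)
      ≈⟨ ◇-congˡ (basis R k) (bilinear-basis qs l m) ⟩
    basis R k ◇ qs l m
      ≈⟨ linear-basis (λ n → linear R (qs n) (qs l m)) k ⟩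
    linear R (qs k) (qs l m) ∎

  ◇-assoc : ∀ p q r → Associative p q r
  ◇-assoc p q r = begin
    (p ◇ q) ◇ r
      ≈⟨ linear-bilinear _ qs p q ⟩
    bilinear R (λ k l → qs k l ◇ r) p q
      -- The flip brings the sum over the monomials `m` of `r` outside, leaving the left side of
      -- `qs-assoc k l m` inside.
      ≈⟨ bilinear-cong (λ k l → trans (bilinear-flip qs (qs k l) r)
                                      (linear-cong (qs-assoc k l) r)) p q ⟩
    linear R (λ k → bilinear R (λ l m → linear R (qs k) (qs l m)) q r) p
      ≈⟨ linear-cong (λ k → linear-bilinear (qs k) qs q r) p ⟨
    p ◇ (q ◇ r) ∎

-- The kernel of `Λ` is a `B₊`-stable ideal containing the relations.

module Kernel {c ℓ} (R : CommutativeRing c ℓ) where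

  open FreeModule R
  open QuasiShuffle R
  open SetoidReasoning (AbelianGroup.setoid (+-abelianGroup (≡.setoid ℕ)))

  private module H′ = H R

  mutual
    -- Independence of the planar representative, by simultaneous induction on isomorphisms of trees
    -- and of forests.
    Λ-tree-cong : ∀ {t u} → t ≅ u → Λ-tree R t ≈ Λ-tree R u
    Λ-tree-cong (node-≅ p) = ▹x-cong (Λ-forest-cong p)

    Λ-forest-cong : ∀ {F G} → Permutation _≅_ F G → Λ-forest R F ≈ Λ-forest R G
    Λ-forest-cong (refl ps)   = Λ-forest-cong* ps
    Λ-forest-cong (prep e p)  = ◇-cong (Λ-tree-cong e) (Λ-forest-cong p)
    -- Exchanging two neighbouring trees is where associativity and commutativity of the product
    -- enter.
    Λ-forest-cong (swap {xs} {ys} {x} {y} {x′} {y′} e f p) = begin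
      Λ-tree R x ◇ (Λ-tree R y ◇ Λ-forest R xs)
        ≈⟨ ◇-assoc (Λ-tree R x) (Λ-tree R y) (Λ-forest R xs) ⟨
      (Λ-tree R x ◇ Λ-tree R y) ◇ Λ-forest R xs
        ≈⟨ ◇-congʳ (Λ-forest R xs) (◇-comm (Λ-tree R x) (Λ-tree R y)) ⟩
      (Λ-tree R y ◇ Λ-tree R x) ◇ Λ-forest R xs
        ≈⟨ ◇-assoc (Λ-tree R y) (Λ-tree R x) (Λ-forest R xs) ⟩
      Λ-tree R y ◇ (Λ-tree R x ◇ Λ-forest R xs)
        ≈⟨ ◇-cong (Λ-tree-cong f) (◇-cong (Λ-tree-cong e) (Λ-forest-cong p)) ⟩
      Λ-tree R y′ ◇ (Λ-tree R x′ ◇ Λ-forest R ys) ∎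
    Λ-forest-cong (trans p q) = trans (Λ-forest-cong p) (Λ-forest-cong q)

    Λ-forest-cong* : ∀ {F G} → Pointwise _≅_ F G → Λ-forest R F ≈ Λ-forest R G
    Λ-forest-cong* []       = refl
    Λ-forest-cong* (e ∷ ps) = ◇-cong (Λ-tree-cong e) (Λ-forest-cong* ps)

  Λ-cong : ∀ {u v} → u H′.≈ v → Λ R u ≈ Λ R v
  Λ-cong = linear-respects-≈ Λ-forest-cong

  Λ-forest-++ : ∀ F G → Λ-forest R (F ++ G) ≈ Λ-forest R F ◇ Λ-forest R G
  Λ-forest-++ []      G = sym (◇-identityˡ (Λ-forest R G))
  Λ-forest-++ (t ∷ F) G =
    trans (◇-congˡ (Λ-tree R t) (Λ-forest-++ F G))
          (sym (◇-assoc (Λ-tree R t) (Λ-forest R F) (Λ-forest R G)))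

  Λ-* : ∀ u v → Λ R (u H′.* v) ≈ Λ R u ◇ Λ R v
  Λ-* u v = begin
    Λ R (u H′.* v)
      ≈⟨ linear-bilinear (Λ-forest R) (λ F G → basis R (F ++ G)) u v ⟩
    bilinear R (λ F G → Λ R (basis R (F ++ G))) u v
      ≈⟨ bilinear-cong (λ F G → trans (linear-basis (Λ-forest R) (F ++ G))
                                      (Λ-forest-++ F G)) u v ⟩
    bilinear R (λ F G → Λ-forest R F ◇ Λ-forest R G) u v
      ≈⟨ bilinear-linear qs (Λ-forest R) (Λ-forest R) u v ⟨
    Λ R u ◇ Λ R v ∎

  Λ-[tree] : ∀ t → Λ R (tree R t) ≈ Λ-tree R t
  Λ-[tree] t = trans (linear-basis (Λ-forest R) [ t ]) (◇-identityʳ (Λ-tree R t))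

  Λ-B₊ : ∀ u → Λ R (B₊ R u) ≈ Λ R u ▹x
  Λ-B₊ u = begin
    Λ R (B₊ R u)                            ≈⟨ linear-linear (Λ-forest R) (λ F → tree R (node F)) u ⟩
    linear R (λ F → Λ R (tree R (node F))) u ≈⟨ linear-cong (λ F → Λ-[tree] (node F)) u ⟩
    linear R (λ F → Λ-forest R F ▹x) u      ≈⟨ linear-linear raise (Λ-forest R) u ⟨
    Λ R u ▹x                                ∎

  Λ-∘ : ∀ F b → Λ R (tree R (node F ∘ b)) ≈ (Λ-forest R F ◇ Λ-tree R b) ▹x
  Λ-∘ F b = trans (Λ-[tree] (node F ∘ b)) (▹x-cong
    (trans (Λ-forest-++ F [ b ])
           (◇-congˡ (Λ-forest R F) (◇-identityʳ (Λ-tree R b)))))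

  -- The three trees in `a ⋈ b` map to the three summands of `◇-▹x` for the images of the forests
  -- `F` and `G` below the roots of `a` and `b`.
  Λ-⋈ : ∀ a b → Λ R (_⋈_ R a b) ≈ Λ-tree R a ◇ Λ-tree R b
  Λ-⋈ a@(node F) b@(node G) = begin
    Λ R (tree R (a ∘ b) + tree R (b ∘ a) + tree R (a ⊗ b))
      ≈⟨ trans (linear-+ (Λ-forest R) (tree R (a ∘ b) + tree R (b ∘ a)) (tree R (a ⊗ b)))
               (+-congʳ _ (linear-+ (Λ-forest R) (tree R (a ∘ b)) (tree R (b ∘ a)))) ⟩
    Λ R (tree R (a ∘ b)) + Λ R (tree R (b ∘ a)) + Λ R (tree R (a ⊗ b))
      ≈⟨ +-cong (+-cong (Λ-∘ F b)
                        (trans (Λ-∘ G a) (▹x-cong (◇-comm (Λ-forest R G) (Λ-tree R a)))))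
                (trans (Λ-[tree] (a ⊗ b)) (▹x-cong (Λ-forest-++ F G))) ⟩
    (Λ-forest R F ◇ Λ-tree R b) ▹x + (Λ-tree R a ◇ Λ-forest R G) ▹x
      + (Λ-forest R F ◇ Λ-forest R G) ▹x
      ≈⟨ ◇-▹x (Λ-forest R F) (Λ-forest R G) ⟨
    Λ-tree R a ◇ Λ-tree R b ∎

  ker-Λ-isStable : IsStableIdealWithRelations R (ker-Λ R)
  ker-Λ-isStable = record
    { isIdeal = record
      { respects-≈ = λ u≈v Λu≈0 → trans (sym (Λ-cong u≈v)) Λu≈0
      ; 0∈         = refl
      ; +-closed   = λ {u} {v} Λu≈0 Λv≈0 →
          trans (linear-+ (Λ-forest R) u v) (+-cong Λu≈0 Λv≈0)
      ; absorbsˡ   = λ r {u} Λu≈0 →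
          -- A zero left factor computes to `[]`, a zero right factor does not; commutativity moves
          -- it to the left.
          trans (Λ-* r u) (trans (◇-congˡ (Λ R r) Λu≈0) (◇-comm (Λ R r) []))
      ; absorbsʳ   = λ r {u} Λu≈0 → trans (Λ-* u r) (◇-congʳ (Λ R r) Λu≈0)
      }
    ; B₊-stable = λ {u} Λu≈0 → trans (Λ-B₊ u) (▹x-cong Λu≈0)
    ; relations = λ a b → begin
        Λ R (_⋈_ R a b - tree R a H′.* tree R b)
          ≈⟨ linear-- (Λ-forest R) (_⋈_ R a b) (tree R a H′.* tree R b) ⟩
        Λ R (_⋈_ R a b) - Λ R (tree R a H′.* tree R b)
          ≈⟨ +-cong (Λ-⋈ a b)
               (neg-cong (trans (Λ-* (tree R a) (tree R b))
                                (◇-cong (Λ-[tree] a) (Λ-[tree] b)))) ⟩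
        Λ-tree R a ◇ Λ-tree R b - Λ-tree R a ◇ Λ-tree R b
          ≈⟨ +-inverseʳ (Λ-tree R a ◇ Λ-tree R b) ⟩
        [] ∎
    }

-- Every `B₊`-stable ideal `J` containing the relations contains the kernel.

module Minimality {c ℓ p} (R : CommutativeRing c ℓ) (J : Pred (H.Carrier R) p)
                  (J-stable : IsStableIdealWithRelations R J) where

  open FreeModule R
  open QuasiShuffle R using (qs; raise; _◇_; _▹x)
  open IsStableIdealWithRelations J-stable
  open IsIdeal isIdeal

  private
    module R = CommutativeRing R
    module H′ = H R
    module G = AbelianGroup (+-abelianGroup forestSetoid)

  open SetoidReasoning G.setoid

  -- Scaling by `α` is multiplication by `α` times the empty forest, so ideals are submodules.
  ∙-closed : ∀ α {u} → u ∈ J → α ∙ u ∈ J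
  ∙-closed α {u} u∈J = respects-≈
    (trans (+-identityʳ _) (∙-congˡ α (linear-identity u)))
    (absorbsˡ ((α , []) ∷ []) u∈J)

  linear-∈ : ∀ {a} {X : Set a} {f : X → H′.Carrier} → (∀ x → f x ∈ J) →
             ∀ u → linear R f u ∈ J
  linear-∈ f∈J []            = 0∈
  linear-∈ f∈J ((α , x) ∷ u) = +-closed (∙-closed α (f∈J x)) (linear-∈ f∈J u)

  infix 4 _≈_ _~_
  _≈_ : H′.Carrier → H′.Carrier → Set _
  _≈_ = H′._≈_

  -- Congruence modulo `J`. A record lets unification recover `u` and `v`, which the computed
  -- difference `u - v` would not.
  record _~_ (u v : H′.Carrier) : Set p where
    constructor congruent
    field difference∈J : u - v ∈ J

  ≈⇒~ : ∀ {u v} → u ≈ v → u ~ v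
  ≈⇒~ {u} {v} u≈v = congruent
    (respects-≈ (trans (sym (+-inverseʳ v)) (+-congʳ (neg R v) (sym u≈v))) 0∈)

  ~-trans : ∀ {u v w} → u ~ v → v ~ w → u ~ w
  ~-trans {u} {v} {w} (congruent u~v) (congruent v~w) =
    congruent (respects-≈ telescope (+-closed u~v v~w))
    where
    telescope : (u - v) + (v - w) ≈ u - w
    telescope = begin
      (u - v) + (v - w)         ≈⟨ G.assoc u (neg R v) (v - w) ⟩
      u + (neg R v + (v - w))   ≈⟨ +-congˡ u (G.assoc (neg R v) v (neg R w)) ⟨
      u + ((neg R v + v) - w)   ≈⟨ +-congˡ u (+-congʳ (neg R w) (G.inverseˡ v)) ⟩
      u - w                     ∎

  ~-sym : ∀ {u v} → u ~ v → v ~ u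
  ~-sym {u} {v} (congruent u~v) =
    congruent (respects-≈ negated (∙-closed (R.- R.1#) u~v))
    where
    negated : (R.- R.1#) ∙ (u - v) ≈ v - u
    negated = begin
      (R.- R.1#) ∙ (u - v)  ≈⟨ neg≈-1∙ (u - v) ⟨
      neg R (u - v)         ≈⟨ GroupProperties.⁻¹-anti-homo-// G.group u v ⟩
      v - u                 ∎

  +-cong-~ : ∀ {u u′ v v′} → u ~ u′ → v ~ v′ → u + v ~ u′ + v′
  +-cong-~ {u} {u′} {v} {v′} (congruent u~u′) (congruent v~v′) = congruent (respects-≈
    (trans (+-interchange u (neg R u′) v (neg R v′))
           (+-congˡ (u + v) (≡⇒≈ (≡.sym (map-++ _ u′ v′)))))
    (+-closed u~u′ v~v′))

  union : Forest → Forest → H′.Carrier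
  union F G = basis R (F ++ G)

  -- One factor is changed at a time: (u - u′)v lies in `J` by absorption on the right, u′(v - v′)
  -- by absorption on the left.
  *-cong-~ : ∀ {u u′ v v′} → u ~ u′ → v ~ v′ → u H′.* v ~ u′ H′.* v′
  *-cong-~ {u} {u′} {v} {v′} (congruent u~u′) (congruent v~v′) = ~-trans
    (congruent (respects-≈ (linear-- (λ F → linear R (union F) v) u u′)
                           (absorbsʳ v u~u′)))
    (congruent (respects-≈ (bilinear--ʳ union u′ v v′) (absorbsˡ u′ v~v′)))

  plant : Forest → H′.Carrier
  plant F = tree R (node F)

  B₊-cong-~ : ∀ {u v} → u ~ v → B₊ R u ~ B₊ R v
  B₊-cong-~ {u} {v} (congruent u~v) =
    congruent (respects-≈ (linear-- plant u v) (B₊-stable u~v))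

  linear-cong-~ : ∀ {a} {X : Set a} {f g : X → H′.Carrier} → (∀ x → f x ~ g x) →
                  ∀ u → linear R f u ~ linear R g u
  linear-cong-~ f~g u = congruent
    (respects-≈ (linear-pointwise-- _ _ u) (linear-∈ (λ x → _~_.difference∈J (f~g x)) u))

  -- Counting vertices from the empty forest makes `ladder n` the counterpart of xⁿ, with the unit
  -- at n = 0.
  ladder : ℕ → Forest
  ladder zero    = []
  ladder (suc n) = [ node (ladder n) ]

  rung : ℕ → H′.Carrier
  rung n = basis R (ladder n)

  -- A section of `Λ`, since `Λ` maps the ladder with n vertices to xⁿ.
  section : Poly R → H′.Carrier
  section = linear R rung

  section-▹x : ∀ q → section (q ▹x) ≈ B₊ R (section q)
  section-▹x q = begin
    section (q ▹x)
      ≈⟨ linear-linear rung raise q ⟩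
    linear R (λ n → section (raise n)) q
      ≈⟨ linear-cong (λ n → trans (linear-basis rung (suc n))
                                  (sym (linear-basis plant (ladder n)))) q ⟩
    linear R (λ n → B₊ R (rung n)) q
      ≈⟨ linear-linear plant rung q ⟨
    B₊ R (section q) ∎

  basis-++ : ∀ F G → basis R (F ++ G) ≈ basis R F H′.* basis R G
  basis-++ F G = sym (bilinear-basis union F G)

  -- Induction along the recursion of `quasiShuffle`. For two nonempty ladders `a` and `b`, the
  -- relation replaces `ab` by three trees, each `B₊` of a product of two ladders with fewer
  -- vertices in total.
  ladder-* : ∀ k l → rung k H′.* rung l ~ section (qs k l)
  ladder-* zero l =
    ≈⇒~ (trans (bilinear-basis union [] (ladder l)) (sym (linear-basis rung l)))
  ladder-* (suc k) zero =
    ≈⇒~ (trans (bilinear-basis union (ladder (suc k)) []) (sym (linear-basis rung (suc k))))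
  ladder-* (suc k) (suc l) = ~-trans (~-sym (congruent (relations a b))) (~-trans
    (+-cong-~ (+-cong-~ (graft (ladder k) (ladder (suc l)) (qs k (suc l)) (ladder-* k (suc l)))
                        (~-trans (≈⇒~ swap-factors)
                                 (graft (ladder (suc k)) (ladder l) (qs (suc k) l) (ladder-* (suc k) l))))
              (graft (ladder k) (ladder l) (qs k l) (ladder-* k l)))
    (≈⇒~ (sym (trans (linear-+ rung (qs k (suc l) ▹x + qs (suc k) l ▹x) (qs k l ▹x))
                     (+-congʳ (section (qs k l ▹x)) (linear-+ rung (qs k (suc l) ▹x) (qs (suc k) l ▹x)))))))
    where
    a = node (ladder k)
    b = node (ladder l)

    -- Carries an induction hypothesis through `B₊`; this is where stability of `J` is used.
    graft : ∀ F G q → basis R F H′.* basis R G ~ section q →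
            tree R (node (F ++ G)) ~ section (q ▹x)
    graft F G q h = ~-trans
      (≈⇒~ (sym (linear-basis plant (F ++ G))))
      (~-trans (B₊-cong-~ (~-trans (≈⇒~ (basis-++ F G)) h))
               (≈⇒~ (sym (section-▹x q))))

    -- `b ∘ a` puts `a` after `ladder l`, while the induction hypothesis has `ladder (suc k)`, which
    -- is `[ a ]`, in front; non-planarity identifies the two trees.
    swap-factors : tree R (b ∘ a) ≈ tree R (node (ladder (suc k) ++ ladder l))
    swap-factors = cons R.refl
      (prep (node-≅ (∷ʳ↭∷ (ladder l) a)) (refl [])) refl
      where
      ∷ʳ↭∷ : ∀ F t → Permutation _≅_ (F ++ [ t ]) (t ∷ F)
      ∷ʳ↭∷ []      t = refl ≅-refl*
      ∷ʳ↭∷ (u ∷ F) t = trans (prep ≅-refl (∷ʳ↭∷ F t)) (swap ≅-refl ≅-refl (refl ≅-refl*))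

  section-◇ : ∀ q r → section q H′.* section r ~ section (q ◇ r)
  section-◇ q r = ~-trans
    (≈⇒~ (bilinear-linear union rung rung q r))
    (~-trans (linear-cong-~ (λ k → linear-cong-~ (ladder-* k) r) q)
             (≈⇒~ (sym (linear-bilinear rung qs q r))))

  mutual
    -- Structural induction: modulo `J`, `section` turns `_▹x` into `B₊` and `_◇_` into the product
    -- of forests, the two operations from which `Λ` is built.
    tree~section-Λ : ∀ t → tree R t ~ section (Λ-tree R t)
    tree~section-Λ (node F) = ~-trans
      (≈⇒~ (sym (linear-basis plant F)))
      (~-trans (B₊-cong-~ (forest~section-Λ F))
               (≈⇒~ (sym (section-▹x (Λ-forest R F)))))

    forest~section-Λ : ∀ F → basis R F ~ section (Λ-forest R F)
    forest~section-Λ []      = ≈⇒~ (sym (linear-basis rung 0))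
    forest~section-Λ (t ∷ F) = ~-trans
      (≈⇒~ (basis-++ [ t ] F))
      (~-trans (*-cong-~ (tree~section-Λ t) (forest~section-Λ F))
               (section-◇ (Λ-tree R t) (Λ-forest R F)))

  id~section-Λ : ∀ u → u ~ section (Λ R u)
  id~section-Λ u = ~-trans
    (≈⇒~ (sym (linear-identity u)))
    (~-trans (linear-cong-~ forest~section-Λ u) (≈⇒~ (sym (linear-linear rung (Λ-forest R) u))))

  ker-Λ⊆ : ker-Λ R ⊆ J
  -- Since `section` respects equality of polynomials, `u` is congruent to `section []`, which is
  -- `[]`; the difference `u - []` computes to `u + []`.
  ker-Λ⊆ {u} Λu≈0 = respects-≈ (+-identityʳ u) (_~_.difference∈J (~-trans (id~section-Λ u)
    (≈⇒~ (linear-respects-≈ {f = rung} (λ { ≡.refl → refl }) Λu≈0))))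

mainTheorem14 : ∀ {c ℓ₁ ℓ₂ p} (K : HeytingField c ℓ₁ ℓ₂) → HasCharacteristicZero K →
    let k = baseRing K in
    IsStableIdealWithRelations k (ker-Λ k) ×
    (∀ (J : Pred (H.Carrier k) p) → IsStableIdealWithRelations k J → ker-Λ k ⊆ J)
mainTheorem14 K _ =
  Kernel.ker-Λ-isStable (baseRing K) , Minimality.ker-Λ⊆ (baseRing K)
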